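{- Let $m\in\mathbb{Z}$ and let $p$ be a prime divisor of $4m-1$. Then $$\nu_p\left(\sum_{k=0}^{n-1}\binom{2k}{k}m^k\right)\geq\nu_p(n)$$ for all $n\in\mathbb{Z}^+$.
   Context: $\mathbb{Z}^+=\{1,2,3,\ldots\}$. For a prime $p$ and an integer $x$, $\nu_p(x)=\sup\{a\in\mathbb{Z}: p^a\mid x\}$ (so $\nu_p(0)=+\infty$). -}

module Defs where

open import Data.Integer.Base using (ℤ; +_; +0; +[1+_]; -[1+_]; ∣_∣)
open import Data.Integer.Divisibility.Signed using (_∣_; _∣?_; divides; ∣⇒∣ᵤ)
open import Data.Nat.Base as ℕ using (ℕ; zero; suc; _^_; _≤_; _<_; z≤n; NonZero; nonTrivial⇒n>1)
import Data.Nat.Divisibility as ℕ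
open import Data.Nat.Primality using (Prime; prime⇒nonTrivial)
import Data.Nat.Properties as ℕ
open import Data.Product.Base using (∃; _×_; _,_; proj₁; proj₂)
open import Relation.Binary.Construct.Add.Supremum.NonStrict ℕ._≤_ public using (_≤⁺_; [_]; _≤⊤⁺)
open import Relation.Binary.PropositionalEquality.Core using (_≡_; refl; sym)
open import Relation.Nullary.Construct.Add.Supremum public using (_⁺; ⊤⁺; [_])
open import Relation.Nullary.Decidable.Core using (yes; no)
open import Relation.Nullary.Negation.Core using (contradiction)
open import Relation.Unary using (Pred; Decidable)
open import Level using (0ℓ)

IsUpperBound : Pred ℕ 0ℓ → ℕ ⁺ → Set
IsUpperBound P u = ∀ a → P a → [ a ] ≤⁺ u

IsSup : Pred ℕ 0ℓ → ℕ ⁺ → Set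
IsSup P s = IsUpperBound P s × (∀ u → IsUpperBound P u → s ≤⁺ u)

-- Only a ≥ 0 is considered: a = 0 always qualifies, so negative exponents
-- could not change the supremum.
PowerDivides : ℕ → ℤ → Pred ℕ 0ℓ
PowerDivides p x a = + (p ^ a) ∣ x

private
  greatest : ∀ {P : Pred ℕ 0ℓ} → Decidable P → P 0 → ∀ N →
             ∃ λ s → P s × (∀ a → a ≤ N → P a → a ≤ s)
  greatest P? p₀ zero = 0 , p₀ , λ a a≤0 _ → a≤0
  greatest P? p₀ (suc N) with P? (suc N)
  ... | yes pN = suc N , pN , λ a a≤N _ → a≤N
  ... | no ¬pN with greatest P? p₀ N
  ...   | s , ps , max = s , ps , bound
    where
    bound : ∀ a → a ≤ suc N → _ → a ≤ s
    bound a a≤1+N pa with a ℕ.≟ suc N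
    ... | yes refl = contradiction pa ¬pN
    ... | no  a≢   = max a (ℕ.s≤s⁻¹ (ℕ.≤∧≢⇒< a≤1+N a≢)) pa

  n<p^n : ∀ {p} → 1 < p → ∀ n → n < p ^ n
  n<p^n     1<p zero    = ℕ.≤-refl
  n<p^n {p} 1<p (suc n) = ℕ.≤-<-trans (n<p^n 1<p n) (ℕ.^-monoʳ-< p 1<p (ℕ.n<1+n n))

  1∣ : ∀ x → + 1 ∣ x
  1∣ x = divides x (sym (*-identityʳ x))
    where open import Data.Integer.Properties using (*-identityʳ)

  sup-nonZero : ∀ p → 1 < p → ∀ x → .{{NonZero ∣ x ∣}} → ∃ (IsSup (PowerDivides p x))
  sup-nonZero p 1<p x with greatest (λ a → + (p ^ a) ∣? x) (1∣ x) ∣ x ∣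
  ... | s , ps , max =
    [ s ] , (λ a pa → [ max a (small a pa) pa ]) , (λ u ub → ub s ps)
    where
    small : ∀ a → PowerDivides p x a → a ≤ ∣ x ∣
    small a pa = ℕ.≤-trans (ℕ.<⇒≤ (n<p^n 1<p a)) (ℕ.∣⇒≤ (∣⇒∣ᵤ pa))

  sup-zero : ∀ p → IsSup (PowerDivides p +0) ⊤⁺
  sup-zero p = (λ a _ → [ a ] ≤⊤⁺) , least
    where
    least : ∀ u → IsUpperBound (PowerDivides p +0) u → ⊤⁺ ≤⁺ u
    least ⊤⁺    _  = ⊤⁺ ≤⊤⁺
    least [ b ] ub with ub (suc b) (divides +0 refl)
    ... | [ b<b ] = contradiction b<b ℕ.1+n≰n

sup-exists : ∀ p → Prime p → ∀ x → ∃ (IsSup (PowerDivides p x))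
sup-exists p _  +0         = ⊤⁺ , sup-zero p
sup-exists p pr x@(+[1+ _ ]) = sup-nonZero p (nonTrivial⇒n>1 p {{prime⇒nonTrivial pr}}) x
sup-exists p pr x@(-[1+ _ ]) = sup-nonZero p (nonTrivial⇒n>1 p {{prime⇒nonTrivial pr}}) x

ν : (p : ℕ) → {{Prime p}} → ℤ → ℕ ⁺
ν p {{pr}} x = proj₁ (sup-exists p pr x)

ν-isSup : ∀ p {{_ : Prime p}} x → IsSup (PowerDivides p x) (ν p x)
ν-isSup p {{pr}} x = proj₂ (sup-exists p pr x)

{-# OPTIONS --safe #-}
-- Put D = 4m - 1 and W(n,j) = Σ_{k<n} 4^(n-k) C(2k,k) C(k,j).  Expanding (4m)^k = (1 + D)^k gives
--   4^n Σ_{k<n} C(2k,k) m^k = Σ_j W(n,j) D^j,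
-- and the inner sums telescope: (2j+1) W(n,j) = 2n C(2n,n) C(n-1,j).  Hence p^a ∣ n implies
-- p^a ∣ (2j+1) W(n,j); as 2j+1 < p^(j+1), the factor D^j makes up for all factors p of 2j+1,
-- so p^a divides every W(n,j) D^j.  Finally p ∤ 4 because p ∣ 4m - 1.
module Submission where

module _ where
  open import Data.Nat.Base
  open import Data.Nat.Combinatorics using (_C_; nC1≡n; nCk≡nC[n∸k]; nCk+nC[k+1]≡[n+1]C[k+1])
  open import Data.Nat.Coprimality using (Coprime; coprime-divisor)
  open import Data.Nat.Divisibility
  open import Data.Nat.Primality
  open import Data.Nat.Properties
  open import Data.Nat.Tactic.RingSolver using (solve-∀)
  open import Data.Product.Base using (_,_)
  open import Data.Sum.Base using (inj₁; inj₂)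
  open import Relation.Binary.PropositionalEquality
  open import Relation.Nullary.Decidable.Core using (yes; no)
  open import Relation.Nullary.Negation.Core using (contradiction)

  -- Binomial and central binomial identities.

  [1+k]*[1+n]C[1+k]≡[1+n]*nCk : ∀ n k → suc k * (suc n C suc k) ≡ suc n * (n C k)
  [1+k]*[1+n]C[1+k]≡[1+n]*nCk zero    zero    = refl
  [1+k]*[1+n]C[1+k]≡[1+n]*nCk zero    (suc k) = *-zeroʳ (2 + k)
  [1+k]*[1+n]C[1+k]≡[1+n]*nCk (suc n) zero    =
    trans (*-identityˡ _) (trans (nC1≡n (2 + n)) (sym (*-identityʳ (2 + n))))
  [1+k]*[1+n]C[1+k]≡[1+n]*nCk (suc n) (suc k) = begin
    (2 + k) * ((2 + n) C (2 + k))
      ≡⟨ cong ((2 + k) *_) (nCk+nC[k+1]≡[n+1]C[k+1] (suc n) (suc k)) ⟨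
    -- One copy of `b` is set aside, so that the coefficients left on `b` and `b′` are those of the
    -- two induction hypotheses.
    (2 + k) * (b + b′)
      ≡⟨ split k b b′ ⟩
    b + (suc k * b + (2 + k) * b′)
      ≡⟨ cong (b +_) (cong₂ _+_ ([1+k]*[1+n]C[1+k]≡[1+n]*nCk n k)
                                ([1+k]*[1+n]C[1+k]≡[1+n]*nCk n (suc k))) ⟩
    b + (suc n * (n C k) + suc n * (n C suc k))
      ≡⟨ cong (b +_) (*-distribˡ-+ (suc n) (n C k) (n C suc k)) ⟨
    b + suc n * (n C k + n C suc k)
      ≡⟨ cong (λ c → b + suc n * c) (nCk+nC[k+1]≡[n+1]C[k+1] n k) ⟩
    (2 + n) * b ∎
    where
    open ≡-Reasoning
    b  = suc n C suc k
    b′ = suc n C suc (suc k)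
    split : ∀ k b b′ → (2 + k) * (b + b′) ≡ b + (suc k * b + (2 + k) * b′)
    split = solve-∀

  centralBinomial : ℕ → ℕ
  centralBinomial n = (2 * n) C n

  -- Pascal's rule splits C(2n+2,n+1) into C(2n+1,n) and C(2n+1,n+1), equal by symmetry; absorption
  -- then lowers the upper index to 2n.
  centralBinomial-suc : ∀ n → suc n * centralBinomial (suc n) ≡ 2 * (suc (2 * n) * centralBinomial n)
  centralBinomial-suc n = begin
    suc n * ((2 * suc n) C suc n)
      ≡⟨ cong (λ k → suc n * (k C suc n)) (*-suc 2 n) ⟩
    suc n * ((2 + 2 * n) C suc n)
      ≡⟨ cong (suc n *_) (nCk+nC[k+1]≡[n+1]C[k+1] (suc (2 * n)) n) ⟨
    suc n * (suc (2 * n) C n + suc (2 * n) C suc n)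
      ≡⟨ cong (λ c → suc n * (c + suc (2 * n) C suc n)) symmetric ⟩
    suc n * (suc (2 * n) C suc n + suc (2 * n) C suc n)
      ≡⟨ double (suc n) (suc (2 * n) C suc n) ⟩
    2 * (suc n * (suc (2 * n) C suc n))
      ≡⟨ cong (2 *_) ([1+k]*[1+n]C[1+k]≡[1+n]*nCk (2 * n) n) ⟩
    2 * (suc (2 * n) * centralBinomial n) ∎
    where
    open ≡-Reasoning
    double : ∀ a b → a * (b + b) ≡ 2 * (a * b)
    double = solve-∀
    complement : ∀ n → suc (2 * n) ≡ suc n + n
    complement = solve-∀
    symmetric : suc (2 * n) C n ≡ suc (2 * n) C suc n
    symmetric = trans (nCk≡nC[n∸k] (m≤n⇒m≤1+n (m≤n*m n 2)))
      (cong (suc (2 * n) C_) (trans (cong (_∸ n) (complement n)) (m+n∸n≡m (suc n) n)))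

  -- Closed form of the weighted sums.

  -- Σ_{k<n} 4^(n-k) C(2k,k) C(k,j), by a recursion that avoids the exponent n - k.
  weightedSum : ℕ → ℕ → ℕ
  weightedSum zero    j = 0
  weightedSum (suc n) j = 4 * (weightedSum n j + centralBinomial n * (n C j))

  -- This is (n+1) C(n,j) = (n+1-j) C(n+1,j) with the subtraction moved across. It lets the closed
  -- form trade C(n,j) for C(n+1,j).
  1+nCj-absorb : ∀ n j → suc n * (n C j) + j * (suc n C j) ≡ suc n * (suc n C j)
  1+nCj-absorb n zero    = +-identityʳ _
  1+nCj-absorb n (suc j) = begin
    suc n * (n C suc j) + suc j * (suc n C suc j)
      ≡⟨ cong (suc n * (n C suc j) +_) ([1+k]*[1+n]C[1+k]≡[1+n]*nCk n j) ⟩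
    suc n * (n C suc j) + suc n * (n C j)
      ≡⟨ +-comm (suc n * (n C suc j)) _ ⟩
    suc n * (n C j) + suc n * (n C suc j)
      ≡⟨ *-distribˡ-+ (suc n) (n C j) (n C suc j) ⟨
    suc n * (n C j + n C suc j)
      ≡⟨ cong (suc n *_) (nCk+nC[k+1]≡[n+1]C[k+1] n j) ⟩
    suc n * (suc n C suc j) ∎
    where open ≡-Reasoning

  weightedSum-closed : ∀ n j →
    suc (2 * j) * weightedSum (suc n) j ≡ 2 * (suc n * centralBinomial (suc n) * (n C j))
  weightedSum-closed zero    zero    = refl
  weightedSum-closed zero    (suc j) = *-zeroʳ (suc (2 * suc j))
  weightedSum-closed (suc n) j       = begin
    suc (2 * j) * (4 * (w + c * b′))
      ≡⟨ expand j w c b′ ⟩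
    4 * (suc (2 * j) * w) + 4 * (suc (2 * j) * (c * b′))
      ≡⟨ cong (λ x → 4 * x + 4 * (suc (2 * j) * (c * b′))) (weightedSum-closed n j) ⟩
    4 * (2 * (suc n * c * b)) + 4 * (suc (2 * j) * (c * b′))
      ≡⟨ collect n j c b b′ ⟩
    4 * c * (2 * (suc n * b + j * b′) + b′)
      ≡⟨ cong (λ x → 4 * c * (2 * x + b′)) (1+nCj-absorb n j) ⟩
    4 * c * (2 * (suc n * b′) + b′)
      -- The bracket is (2n+3) `b′`, and 2(2n+3) is exactly the factor that raises the central
      -- binomial from n+1 to n+2.
      ≡⟨ factor n c b′ ⟩
    2 * (2 * (suc (2 * suc n) * c) * b′)
      ≡⟨ cong (λ x → 2 * (x * b′)) (centralBinomial-suc (suc n)) ⟨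
    2 * ((2 + n) * centralBinomial (2 + n) * b′) ∎
    where
    open ≡-Reasoning
    w  = weightedSum (suc n) j
    c  = centralBinomial (suc n)
    b  = n C j
    b′ = suc n C j
    expand : ∀ j w c b′ → suc (2 * j) * (4 * (w + c * b′)) ≡
                          4 * (suc (2 * j) * w) + 4 * (suc (2 * j) * (c * b′))
    expand = solve-∀
    collect : ∀ n j c b b′ → 4 * (2 * (suc n * c * b)) + 4 * (suc (2 * j) * (c * b′)) ≡
                             4 * c * (2 * (suc n * b + j * b′) + b′)
    collect = solve-∀
    factor : ∀ n c b′ → 4 * c * (2 * (suc n * b′) + b′) ≡ 2 * (2 * (suc (2 * suc n) * c) * b′)
    factor = solve-∀

  n∣[1+2j]*weightedSum : ∀ n j → n ∣ suc (2 * j) * weightedSum n j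
  n∣[1+2j]*weightedSum zero    j = ∣-reflexive (sym (*-zeroʳ (suc (2 * j))))
  n∣[1+2j]*weightedSum (suc n) j = subst (suc n ∣_) (sym (weightedSum-closed n j))
    (∣n⇒∣m*n 2 (∣m⇒∣m*n (n C j) (m∣m*n (centralBinomial (suc n)))))

  -- Removing the factors p from 2j+1.

  1+2j<p^[1+j] : ∀ {p} → 1 < p → ∀ j → suc (2 * j) < p ^ suc j
  1+2j<p^[1+j] {p} 1<p zero    = subst (1 <_) (sym (*-identityʳ p)) 1<p
  1+2j<p^[1+j] {p} 1<p (suc j) = begin-strict
    suc (2 * suc j)       ≡⟨ cong suc (*-suc 2 j) ⟩
    3 + 2 * j             ≤⟨ s≤s (s≤s (s≤s (m≤m+n (2 * j) (2 * j)))) ⟩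
    3 + (2 * j + 2 * j)   <⟨ n<1+n _ ⟩
    4 + (2 * j + 2 * j)   ≡⟨ double j ⟩
    -- Unfolding `<`, the induction hypothesis reads `2 + 2 * j ≤ p ^ suc j`, and `1 < p` reads
    -- `2 ≤ p`.
    2 * (2 + 2 * j)       ≤⟨ *-mono-≤ 1<p (1+2j<p^[1+j] 1<p j) ⟩
    p * p ^ suc j         ∎
    where
    open ≤-Reasoning
    double : ∀ j → 4 + (2 * j + 2 * j) ≡ 2 * (2 + 2 * j)
    double = solve-∀

  module _ {p : ℕ} (pr : Prime p) where

    -- A common divisor `i` of p^(a+1) and `d` is coprime to p, since otherwise p would divide `i`
    -- and hence `d`. So `i` already divides p^a, and induction applies.
    ∤⇒coprime-^ : ∀ {d} → p ∤ d → ∀ a → Coprime (p ^ a) d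
    ∤⇒coprime-^ p∤d zero    (i∣1 , _) = ∣1⇒≡1 i∣1
    ∤⇒coprime-^ p∤d (suc a) {i} (i∣p*p^a , i∣d) =
      ∤⇒coprime-^ p∤d a (coprime-divisor coprime-ip i∣p*p^a , i∣d)
      where
      coprime-ip : Coprime i p
      coprime-ip (e∣i , e∣p) with prime⇒irreducible pr e∣p
      ... | inj₁ e≡1  = e≡1
      ... | inj₂ refl = contradiction (∣-trans e∣i i∣d) p∤d

    -- Since 0 < d < p ^ (j + 1), at most j factors p can be stripped from d.
    p^a∣d*w⇒p^a∣p^j*w : ∀ {a} j d w → .{{NonZero d}} → d < p ^ suc j →
                        p ^ a ∣ d * w → p ^ a ∣ p ^ j * w
    p^a∣d*w⇒p^a∣p^j*w {a} j d w d< p^a∣d*w with p ∣? d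
    ... | no p∤d = ∣n⇒∣m*n (p ^ j) (coprime-divisor (∤⇒coprime-^ p∤d a) p^a∣d*w)
    p^a∣d*w⇒p^a∣p^j*w {a} zero d w d< _ | yes p∣d =
      contradiction (<-≤-trans d< (≤-trans (≤-reflexive (*-identityʳ p)) (∣⇒≤ p∣d))) (<-irrefl refl)
    p^a∣d*w⇒p^a∣p^j*w {a} (suc j) .(e * p) w d< p^a∣d*w | yes (divides-refl e) =
      -- With d = e p, one factor p moves from `d` over to `w`; cancelling p in the bound on `d`
      -- gives `e < p ^ suc j`, as the recursive call needs.
      subst (p ^ a ∣_) (regroup (p ^ j) p w)
        (p^a∣d*w⇒p^a∣p^j*w {a} j e (p * w) {{m*n≢0⇒m≢0 e}}
          (*-cancelˡ-< p e (p ^ suc j) (subst (_< p ^ (2 + j)) (*-comm e p) d<))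
          (subst (p ^ a ∣_) (*-assoc e p w) p^a∣d*w))
      where
      regroup : ∀ x p w → x * (p * w) ≡ p * x * w
      regroup = solve-∀

open import Defs
open import Data.Integer.Properties using (+-0-commutativeMonoid)
open import Algebra.Properties.CommutativeMonoid.Sum +-0-commutativeMonoid using (sum-syntax)
open import Data.Fin.Base using (toℕ)
open import Data.Integer.Base using (ℤ; +_; _*_; _^_; _-_)
open import Data.Integer.Divisibility.Signed using (_∣_)
open import Data.Nat.Base as ℕ using (ℕ; NonZero)
open import Data.Nat.Combinatorics using (_C_)
open import Data.Nat.Primality using (Prime)

open import Algebra.Properties.CommutativeMonoid.Sum +-0-commutativeMonoid
  using (sum; sum-cong-≗; sum-replicate-zero; ∑-distrib-+)
open import Data.Fin.Base using (Fin; zero; suc)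
open import Data.Integer.Base using (+0; _+_)
open import Data.Integer.Coprimality using (coprime-divisor)
open import Data.Integer.Divisibility.Signed
  using (divides; ∣-refl; ∣-trans; ∣m∣n⇒∣m+n; ∣m∣n⇒∣m-n; ∣m⇒∣m*n; *-monoʳ-∣; *-monoˡ-∣; ∣⇒∣ᵤ; ∣ᵤ⇒∣)
open import Data.Integer.Properties
  using (+-*-semiring; +-identityˡ; +-identityʳ; +-assoc; *-identityˡ; *-assoc; pos-+; pos-*)
open import Data.Integer.Tactic.RingSolver using (solve-∀)
open import Algebra.Properties.Semiring.Sum +-*-semiring using (*-distribˡ-sum)
open import Data.Nat.Base using (zero; suc; nonTrivial⇒n>1)
import Data.Nat.Divisibility as ℕ
open import Data.Nat.Combinatorics using (nCk+nC[k+1]≡[n+1]C[k+1])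
open import Data.Nat.Primality using (prime⇒nonTrivial)
import Data.Nat.Properties as ℕ
open import Data.Product.Base using (proj₁; proj₂)
open import Function.Base using (_∘_)
open import Relation.Binary.PropositionalEquality

-- Integer sums and powers.

-- Sums over `Fin` unfold at the first index, whereas the induction on n below adds the last term.
sum-snoc : ∀ (f : ℕ → ℤ) n → ∑[ k < suc n ] f (toℕ k) ≡ ∑[ k < n ] f (toℕ k) + f n
sum-snoc f zero    = trans (+-identityʳ (f 0)) (sym (+-identityˡ (f 0)))
sum-snoc f (suc n) = trans (cong (λ s → f 0 + s) (sum-snoc (f ∘ suc) n)) (sym (+-assoc (f 0) _ _))

∣-sum : ∀ {d n} (f : Fin n → ℤ) → (∀ i → d ∣ f i) → d ∣ sum f
∣-sum {n = zero}  f d∣f = divides +0 refl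
∣-sum {n = suc n} f d∣f = ∣m∣n⇒∣m+n (d∣f zero) (∣-sum (f ∘ suc) (d∣f ∘ suc))

^-monoˡ-∣ : ∀ {x y} → x ∣ y → ∀ n → x ^ n ∣ y ^ n
^-monoˡ-∣         x∣y zero    = ∣-refl
^-monoˡ-∣ {x} {y} x∣y (suc n) =
  ∣-trans (*-monoʳ-∣ x (^-monoˡ-∣ x∣y n)) (*-monoˡ-∣ (y ^ n) x∣y)

pos-^ : ∀ m n → + (m ℕ.^ n) ≡ (+ m) ^ n
pos-^ m zero    = refl
pos-^ m (suc n) = trans (pos-* m (m ℕ.^ n)) (cong (+ m *_) (pos-^ m n))

*-distrib-^ : ∀ x y n → (x * y) ^ n ≡ x ^ n * y ^ n
*-distrib-^ x y zero    = refl
*-distrib-^ x y (suc n) = trans (cong (x * y *_) (*-distrib-^ x y n)) (interchange x y (x ^ n) (y ^ n))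
  where
  interchange : ∀ x y u v → x * y * (u * v) ≡ x * u * (y * v)
  interchange = solve-∀

-- Expansion of the sum in powers of 4m - 1.

-- Terms with j > k vanish, so any length N > k will do. This freedom lets the expansions for
-- different k share one length and be added termwise.
binomialExpansion : ∀ x k N → k ℕ.< N → ∑[ j < N ] (+ (k C toℕ j) * x ^ toℕ j) ≡ (+ 1 + x) ^ k
binomialExpansion x zero    (suc N) _    = cong (λ s → + 1 + s) (sum-replicate-zero N)
binomialExpansion x (suc k) (suc N) k<N = begin
  + 1 + ∑[ j < N ] (+ (suc k C suc (toℕ j)) * x ^ suc (toℕ j))
    ≡⟨ cong (λ s → + 1 + s) (sum-cong-≗ {N} (pascal ∘ toℕ)) ⟩
  + 1 + ∑[ j < N ] (x * term (toℕ j) + term (suc (toℕ j)))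
    ≡⟨ cong (λ s → + 1 + s) (∑-distrib-+ {N} (λ j → x * term (toℕ j)) (λ j → term (suc (toℕ j)))) ⟩
  + 1 + (∑[ j < N ] (x * term (toℕ j)) + ∑[ j < N ] term (suc (toℕ j)))
    ≡⟨ cong (λ s → + 1 + (s + ∑[ j < N ] term (suc (toℕ j)))) (*-distribˡ-sum {N} x (term ∘ toℕ)) ⟨
  + 1 + (x * ∑[ j < N ] term (toℕ j) + ∑[ j < N ] term (suc (toℕ j)))
    -- The leading 1 is the term of index 0, which completes the shifted sum to length `suc N`. The
    -- induction hypothesis is then used at both lengths.
    ≡⟨ regroup x (∑[ j < N ] term (toℕ j)) (∑[ j < N ] term (suc (toℕ j))) ⟩
  ∑[ j < suc N ] term (toℕ j) + x * ∑[ j < N ] term (toℕ j)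
    ≡⟨ cong₂ (λ s t → s + x * t) (binomialExpansion x k (suc N) (ℕ.m<n⇒m<1+n (ℕ.s<s⁻¹ k<N)))
                                 (binomialExpansion x k N (ℕ.s<s⁻¹ k<N)) ⟩
  (+ 1 + x) ^ k + x * (+ 1 + x) ^ k
    ≡⟨ factor x ((+ 1 + x) ^ k) ⟩
  (+ 1 + x) ^ suc k ∎
  where
  open ≡-Reasoning
  term : ℕ → ℤ
  term j = + (k C j) * x ^ j
  regroup : ∀ x s t → + 1 + (x * s + t) ≡ + 1 + t + x * s
  regroup = solve-∀
  factor : ∀ x y → y + x * y ≡ (+ 1 + x) * y
  factor = solve-∀
  distribute : ∀ x a b y → (a + b) * (x * y) ≡ x * (a * y) + b * (x * y)
  distribute = solve-∀
  pascal : ∀ j → + (suc k C suc j) * x ^ suc j ≡ x * term j + term (suc j)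
  pascal j = trans
    (cong (λ c → + c * x ^ suc j) (sym (nCk+nC[k+1]≡[n+1]C[k+1] k j)))
    (trans (cong (_* x ^ suc j) (pos-+ (k C j) (k C suc j)))
           (distribute x (+ (k C j)) (+ (k C suc j)) (x ^ j)))

-- Induction on n with N held fixed: the new last term contributes (4m)^n = (1+x)^n, whose expansion
-- matches the recursion of `weightedSum` coefficient by coefficient.
4^n*sum≡∑weightedSum : ∀ m x → + 4 * m ≡ + 1 + x → ∀ n N → n ℕ.≤ N →
  (+ 4) ^ n * ∑[ k < n ] (+ centralBinomial (toℕ k) * m ^ toℕ k) ≡
  ∑[ j < N ] (+ weightedSum n (toℕ j) * x ^ toℕ j)
4^n*sum≡∑weightedSum m x 4m≡1+x zero    N _   = sym (sum-replicate-zero N)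
4^n*sum≡∑weightedSum m x 4m≡1+x (suc n) N n<N = begin
  (+ 4) ^ suc n * ∑[ k < suc n ] (+ centralBinomial (toℕ k) * m ^ toℕ k)
    ≡⟨ cong ((+ 4) ^ suc n *_) (sum-snoc (λ k → + centralBinomial k * m ^ k) n) ⟩
  (+ 4) ^ suc n * (s + c * m ^ n)
    ≡⟨ expand ((+ 4) ^ n) s c (m ^ n) ⟩
  + 4 * ((+ 4) ^ n * s) + + 4 * c * ((+ 4) ^ n * m ^ n)
    ≡⟨ cong (λ y → + 4 * ((+ 4) ^ n * s) + + 4 * c * y) [4m]^n ⟩
  + 4 * ((+ 4) ^ n * s) + + 4 * c * (+ 1 + x) ^ n
    ≡⟨ cong₂ (λ y z → + 4 * y + + 4 * c * z)
             (4^n*sum≡∑weightedSum m x 4m≡1+x n N (ℕ.<⇒≤ n<N))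
             (sym (binomialExpansion x n N n<N)) ⟩
  + 4 * ∑[ j < N ] w (toℕ j) + + 4 * c * ∑[ j < N ] b (toℕ j)
    ≡⟨ cong₂ _+_ (*-distribˡ-sum {N} (+ 4) (w ∘ toℕ)) (*-distribˡ-sum {N} (+ 4 * c) (b ∘ toℕ)) ⟩
  ∑[ j < N ] (+ 4 * w (toℕ j)) + ∑[ j < N ] (+ 4 * c * b (toℕ j))
    ≡⟨ ∑-distrib-+ {N} (λ j → + 4 * w (toℕ j)) (λ j → + 4 * c * b (toℕ j)) ⟨
  ∑[ j < N ] (+ 4 * w (toℕ j) + + 4 * c * b (toℕ j))
    ≡⟨ sum-cong-≗ {N} (recurrence ∘ toℕ) ⟨
  ∑[ j < N ] (+ weightedSum (suc n) (toℕ j) * x ^ toℕ j) ∎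
  where
  open ≡-Reasoning
  s = ∑[ k < n ] (+ centralBinomial (toℕ k) * m ^ toℕ k)
  c = + centralBinomial n
  w b : ℕ → ℤ
  w j = + weightedSum n j * x ^ j
  b j = + (n C j) * x ^ j
  [4m]^n : (+ 4) ^ n * m ^ n ≡ (+ 1 + x) ^ n
  [4m]^n = trans (sym (*-distrib-^ (+ 4) m n)) (cong (_^ n) 4m≡1+x)
  expand : ∀ f s c y → + 4 * f * (s + c * y) ≡ + 4 * (f * s) + + 4 * c * (f * y)
  expand = solve-∀
  distribute : ∀ u c v y → + 4 * (u + c * v) * y ≡ + 4 * (u * y) + + 4 * c * (v * y)
  distribute = solve-∀
  recurrence : ∀ j → + weightedSum (suc n) j * x ^ j ≡ + 4 * w j + + 4 * c * b j
  recurrence j = trans (cong (_* x ^ j) cast) (distribute (+ weightedSum n j) c (+ (n C j)) (x ^ j))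
    where
    cast : + weightedSum (suc n) j ≡ + 4 * (+ weightedSum n j + c * + (n C j))
    cast = trans (pos-* 4 (weightedSum n j ℕ.+ centralBinomial n ℕ.* (n C j))) (cong (+ 4 *_)
      (trans (pos-+ (weightedSum n j) _) (cong (λ s → + weightedSum n j + s) (pos-* (centralBinomial n) (n C j)))))

-- Divisibility of the sum by powers of p.

module _ (m : ℤ) {p : ℕ} (pr : Prime p) (p∣4m-1 : + p ∣ + 4 * m - + 1) where

  p∤4 : p ℕ.∤ 4
  p∤4 p∣4 = ℕ.<⇒≢ (nonTrivial⇒n>1 p {{prime⇒nonTrivial pr}}) (sym (ℕ.∣1⇒≡1 (∣⇒∣ᵤ p∣1)))
    where
    cancel : ∀ y → y - (y - + 1) ≡ + 1
    cancel = solve-∀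
    p∣1 : + p ∣ + 1
    p∣1 = subst (+ p ∣_) (cancel (+ 4 * m)) (∣m∣n⇒∣m-n (∣m⇒∣m*n m (∣ᵤ⇒∣ {i = + 4} p∣4)) p∣4m-1)

  p^a∣weightedSum*D^j : ∀ {a n} → p ℕ.^ a ℕ.∣ n → ∀ j →
                        + (p ℕ.^ a) ∣ + weightedSum n j * (+ 4 * m - + 1) ^ j
  p^a∣weightedSum*D^j {a} {n} p^a∣n j = ∣-trans p^a∣w*p^j (*-monoʳ-∣ (+ w) (^-monoˡ-∣ p∣4m-1 j))
    where
    w = weightedSum n j
    p^a∣w*p^j : + (p ℕ.^ a) ∣ + w * (+ p) ^ j
    p^a∣w*p^j = subst (+ (p ℕ.^ a) ∣_)
      (trans (cong +_ (ℕ.*-comm (p ℕ.^ j) w)) (trans (pos-* w (p ℕ.^ j)) (cong (+ w *_) (pos-^ p j))))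
      -- Here d = 2j+1, so p^a divides p^j W(n,j); p^j is then replaced by its multiple D^j.
      (∣ᵤ⇒∣ (p^a∣d*w⇒p^a∣p^j*w pr {a} j (suc (2 ℕ.* j)) w
        (1+2j<p^[1+j] (nonTrivial⇒n>1 p {{prime⇒nonTrivial pr}}) j)
        (ℕ.∣-trans p^a∣n (n∣[1+2j]*weightedSum n j))))

  p^a∣n⇒p^a∣sum : ∀ {a n} → p ℕ.^ a ℕ.∣ n →
                  + (p ℕ.^ a) ∣ ∑[ k < n ] (+ centralBinomial (toℕ k) * m ^ toℕ k)
  p^a∣n⇒p^a∣sum {a} {n} p^a∣n = strip n
    (subst (+ (p ℕ.^ a) ∣_) (sym (4^n*sum≡∑weightedSum m (+ 4 * m - + 1) (1+D m) n n ℕ.≤-refl))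
      (∣-sum {n = n} _ (λ j → p^a∣weightedSum*D^j {a} p^a∣n (toℕ j))))
    where
    1+D : ∀ m → + 4 * m ≡ + 1 + (+ 4 * m - + 1)
    1+D = solve-∀
    strip : ∀ k {x} → + (p ℕ.^ a) ∣ (+ 4) ^ k * x → + (p ℕ.^ a) ∣ x
    strip zero    {x} = subst (+ (p ℕ.^ a) ∣_) (*-identityˡ x)
    -- Each factor 4 is cancelled separately, being coprime to p^a.
    strip (suc k) {x} q = strip k (∣ᵤ⇒∣ (coprime-divisor (+ (p ℕ.^ a)) (+ 4) ((+ 4) ^ k * x)
      (∤⇒coprime-^ pr p∤4 a) (∣⇒∣ᵤ (subst (+ (p ℕ.^ a) ∣_) (*-assoc (+ 4) ((+ 4) ^ k) x) q))))

-- From divisibility to valuations.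

-- The supremum for `y` bounds every exponent admissible for `x`, and the supremum for `x` is the
-- least such bound. Infinite values need no separate case.
ν-mono : ∀ {p} {{_ : Prime p}} x y → (∀ a → + (p ℕ.^ a) ∣ x → + (p ℕ.^ a) ∣ y) → ν p x ≤⁺ ν p y
ν-mono {p} x y x⇒y =
  proj₂ (ν-isSup p x) (ν p y) (λ a p^a∣x → proj₁ (ν-isSup p y) a (x⇒y a p^a∣x))

corollary1p1 : (m : ℤ) (p : ℕ) {{_ : Prime p}} → + p ∣ + 4 * m - + 1 →
    (n : ℕ) .{{_ : NonZero n}} →
    ν p (+ n) ≤⁺ ν p (∑[ k < n ] (+ ((2 ℕ.* toℕ k) C toℕ k) * m ^ toℕ k))
corollary1p1 m p {{pr}} p∣4m-1 n =
  ν-mono (+ n) (∑[ k < n ] (+ centralBinomial (toℕ k) * m ^ toℕ k))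
    (λ a p^a∣n → p^a∣n⇒p^a∣sum m pr p∣4m-1 {a} (∣⇒∣ᵤ p^a∣n))
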